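{- Let $h\ge 2$. For $d=2$ and for every odd $d\ge 3$, $\#\mathrm{BWpebbles}(T^h_d)=\lceil (d-1)h/2\rceil+1$, and for odd $d$ this value is unchanged if white sliding moves are additionally allowed. For every even $d\ge 2$, $\#\mathrm{BWpebbles}(T^h_d)\le\lceil (d-1)h/2\rceil+1$.
   Context: $T^h_d$ is the balanced rooted $d$-ary tree with $h$ levels (height counts levels). A whole black-white pebble configuration assigns to each node $i$ values $b(i),w(i)\in\{0,1\}$ with $b(i)+w(i)\le1$ (a black pebble, a white pebble, or none); the number of pebbles is the total number of pebbled nodes. Moves: (i) remove a black pebble from any node; (ii) place a white pebble on any empty node; (iii) if every child of node $i$ carries a pebble (black or white; vacuous for leaves), then remove the white pebble from $i$ (if any) and/or place a black pebble on $i$, simultaneously removing any black pebbles from children of $i$ (black sliding). A black-white pebbling with $p$ pebbles starts and ends with no pebbles, has a black pebble on the root at some point, and never has more than $p$ pebbles. $\#\mathrm{BWpebbles}(T)$ is the minimum such $p$. A white sliding move, when allowed, is: if $i$ carries a white pebble and every child of $i$ except one child $j$ carries a pebble, move the white pebble from $i$ to $j$. -}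

module Defs where

open import Data.Nat using (ℕ; zero; suc; _+_; _*_; _∸_; _≤_; ⌈_/2⌉)
open import Data.Bool using (Bool; true; false)
open import Data.Fin using (Fin; inject₁; fromℕ)
import Data.Fin as F
open import Data.Vec using (Vec; lookup; _[_]≔_; replicate; map; sum)
open import Data.Vec.Relation.Unary.All using (All)
open import Data.Unit using (⊤; tt)
open import Data.Empty using (⊥)
open import Data.Product using (_×_; _,_; ∃-syntax; Σ-syntax)
open import Relation.Binary.PropositionalEquality using (_≡_; _≢_)

-- Content of a node: no pebble, a black pebble, or a white pebble
-- (this encodes b(i),w(i) ∈ {0,1} with b(i)+w(i) ≤ 1).
data Peb : Set where
  none black white : Peb

-- A whole black-white pebble configuration on the balanced rooted d-ary
-- tree with h levels T^h_d, described recursively: a tree with 0 levels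
-- has no nodes; a tree with suc h levels is a root together with d
-- subtrees with h levels each (the subtrees rooted at the children).
Conf : ℕ → ℕ → Set
Conf d zero    = ⊤
Conf d (suc h) = Peb × Vec (Conf d h) d

-- The root of the (sub)tree carries a pebble.  For the empty tree
-- (children of a leaf) this is vacuously true, so that "every child is
-- pebbled" is vacuous for leaves.
occupied : ∀ {d h} → Conf d h → Set
occupied {h = zero}  _        = ⊤
occupied {h = suc h} (p , _)  = p ≢ none

rootEmpty : ∀ {d h} → Conf d h → Set
rootEmpty {h = zero}  _       = ⊥
rootEmpty {h = suc h} (p , _) = p ≡ none

rootBlack : ∀ {d h} → Conf d h → Set
rootBlack {h = zero}  _       = ⊥
rootBlack {h = suc h} (p , _) = p ≡ black

unblack : ∀ {d h} → Conf d h → Conf d h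
unblack {h = zero}  c             = c
unblack {h = suc h} (black , cs)  = none , cs
unblack {h = suc h} (p , cs)      = p , cs

setWhite : ∀ {d h} → Conf d h → Conf d h
setWhite {h = zero}  c        = c
setWhite {h = suc h} (_ , cs) = white , cs

cnt : Peb → ℕ
cnt none  = 0
cnt black = 1
cnt white = 1

pebbles : ∀ {d h} → Conf d h → ℕ
pebbles {h = zero}  _        = 0
pebbles {h = suc h} (p , cs) = cnt p + sum (map pebbles cs)

emptyConf : ∀ {d h} → Conf d h
emptyConf {d} {zero}  = tt
emptyConf {d} {suc h} = none , replicate d emptyConf

data SlideChange : Peb → Peb → Set where
  white→none  : SlideChange white none
  white→black : SlideChange white black
  none→black  : SlideChange none black

-- Moves performed at the root of a (sub)tree with suc h levels, given
-- as (root content, children subtrees) before and after.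
-- The flag ws says whether white sliding moves are allowed.
data RootMove (ws : Bool) {d h : ℕ} :
       Peb → Vec (Conf d h) d → Peb → Vec (Conf d h) d → Set where
  removeBlack : ∀ {cs} → RootMove ws black cs none cs
  placeWhite  : ∀ {cs} → RootMove ws none cs white cs
  slide : ∀ {cs p p′} → All occupied cs → SlideChange p p′ →
          RootMove ws p cs p′ (map unblack cs)
  whiteSlide : ∀ {cs} → ws ≡ true → (j : Fin d) →
          (∀ k → k ≢ j → occupied (lookup cs k)) →
          rootEmpty (lookup cs j) →
          RootMove ws white cs none (cs [ j ]≔ setWhite (lookup cs j))

data Step (ws : Bool) {d : ℕ} : {h : ℕ} → Conf d h → Conf d h → Set where
  atRoot : ∀ {h p cs p′ cs′} → RootMove ws {d} {h} p cs p′ cs′ →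
           Step ws {h = suc h} (p , cs) (p′ , cs′)
  inChild : ∀ {h p} {cs : Vec (Conf d h) d} (i : Fin d) {c′ : Conf d h} →
           Step ws (lookup cs i) c′ →
           Step ws {h = suc h} (p , cs) (p , cs [ i ]≔ c′)

record Pebbling (ws : Bool) (d h p : ℕ) : Set where
  field
    n        : ℕ
    seq      : Fin (suc n) → Conf d h
    start    : seq F.zero ≡ emptyConf
    finish   : seq (fromℕ n) ≡ emptyConf
    steps    : ∀ (i : Fin n) → Step ws (seq (inject₁ i)) (seq (F.suc i))
    rootHit  : ∃[ i ] rootBlack (seq i)
    bounded  : ∀ (i : Fin (suc n)) → pebbles (seq i) ≤ p

IsBWpebbles : Bool → ℕ → ℕ → ℕ → Set
IsBWpebbles ws d h k = Pebbling ws d h k × (∀ p → Pebbling ws d h p → k ≤ p)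

bound : ℕ → ℕ → ℕ
bound d h = ⌈ (d ∸ 1) * h /2⌉ + 1

{-# OPTIONS --safe #-}
module Submission where

-- Lower bound: at some moment v all children of the root are pebbled, and the subtree of
-- each child is nonempty from v to a moment (before or after v) at which it carries the
-- number of pebbles required by its height.  If d = 2 m + 1, then m + 1 of these moments
-- are on the same side of v, and at the one closest to v the other m subtrees still hold
-- a pebble each, so every level costs m more pebbles.  If d = 2, nothing is gained at a
-- single level, but two levels cost one more pebble.
--
-- Upper bound: pebble half of the children black one after the other, run the strategy
-- recursively on one more child, and when its root is black put white pebbles on the
-- remaining children and slide; clear the white pebbles afterwards.

open import Defs
open import Data.Nat using (ℕ; zero; suc; _+_; _*_; _∸_; _/_; _≤_; _<_; _%_; z≤n; s≤s; ⌈_/2⌉; _⊔_; _≤?_)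
open import Data.Nat.Properties
open import Data.Nat.DivMod using (m≡m%n+[m/n]*n)
open import Data.Nat.Tactic.RingSolver using (solve-∀)
open import Data.Bool using (Bool; true; false)
open import Data.Empty using (⊥-elim)
open import Data.Fin using (Fin; inject₁; fromℕ; toℕ)
import Data.Fin as F
import Data.Fin.Properties as Fₚ
open import Data.Product using (_×_; _,_; proj₁; proj₂; ∃-syntax)
open import Data.Sum using (_⊎_; inj₁; inj₂)
open import Data.Unit using (⊤; tt)
open import Data.Vec using (Vec; []; _∷_; _++_; lookup; _[_]≔_; replicate; map; sum; tabulate)
open import Data.Vec.Properties using (lookup-map; lookup∘update; lookup∘update′; tabulate∘lookup; tabulate-∘; map-++; map-replicate; sum-++)
open import Data.Vec.Relation.Unary.All as All using (All; []; _∷_)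
open import Data.Vec.Relation.Unary.All.Properties using (++⁺; lookup⁺)
open import Function using (_∘_; flip)
open import Level using (0ℓ)
open import Relation.Binary using (Rel; Transitive; Total)
open import Relation.Binary.PropositionalEquality
open import Relation.Nullary using (Dec; yes; no; ¬_)

-- Lower bound

private variable
  ws : Bool
  d h n : ℕ

-- Idle moments are allowed because a move elsewhere in the tree leaves the subtree of a given child
-- unchanged.
Run : Bool → (ℕ → Conf d h) → Set
Run ws f = ∀ t → f t ≡ f (suc t) ⊎ Step ws (f t) (f (suc t))

root : Conf d (suc h) → Peb
root = proj₁

child : Fin d → Conf d (suc h) → Conf d h
child i c = lookup (proj₂ c) i

unblack-step : (c : Conf d h) → c ≡ unblack c ⊎ Step ws c (unblack c)
unblack-step {h = zero}  _            = inj₁ refl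
unblack-step {h = suc h} (none , _)   = inj₁ refl
unblack-step {h = suc h} (black , _)  = inj₂ (atRoot removeBlack)
unblack-step {h = suc h} (white , _)  = inj₁ refl

setWhite-step : (c : Conf d h) → rootEmpty c → Step ws c (setWhite c)
setWhite-step {h = suc h} (none , _) refl = atRoot placeWhite

-- A root move changes a child only by removing its black pebble or, under white sliding, by placing
-- a white pebble on it; both are legal moves inside the child's subtree.
child-step : ∀ {c c′ : Conf d (suc h)} i → Step ws c c′ →
             child i c ≡ child i c′ ⊎ Step ws (child i c) (child i c′)
child-step i (atRoot removeBlack) = inj₁ refl
child-step i (atRoot placeWhite)  = inj₁ refl
child-step {ws = ws} i (atRoot (slide {cs = cs} _ _)) =
  subst (λ c → lookup cs i ≡ c ⊎ Step ws (lookup cs i) c)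
        (sym (lookup-map i unblack cs)) (unblack-step (lookup cs i))
child-step i (atRoot (whiteSlide {cs = cs} _ j _ empty)) with i F.≟ j
... | yes refl = inj₂ (subst (Step _ (lookup cs i)) (sym (lookup∘update i cs _))
                         (setWhite-step (lookup cs i) empty))
... | no  i≢j  = inj₁ (sym (lookup∘update′ i≢j cs _))
child-step i (inChild {cs = cs} j s) with i F.≟ j
... | yes refl = inj₂ (subst (Step _ (lookup cs i)) (sym (lookup∘update i cs _)) s)
... | no  i≢j  = inj₁ (sym (lookup∘update′ i≢j cs _))

child-run : ∀ {f : ℕ → Conf d (suc h)} → Run ws f → ∀ i → Run ws (child i ∘ f)
child-run run i t with run t
... | inj₁ eq = inj₁ (cong (child i) eq)
... | inj₂ s  = child-step i s

-- Moments at which a decidable property changes.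

last-change : ∀ {Q : ℕ → Set} → (∀ x → Dec (Q x)) → ∀ {s} t → s ≤ t → ¬ Q s → Q t →
              ∃[ v ] (s ≤ v × v < t × ¬ Q v × (∀ y → v < y → y ≤ t → Q y))
last-change Q? zero z≤n ¬Qs Qt = ⊥-elim (¬Qs Qt)
last-change {Q} Q? {s} (suc t) s≤t ¬Qs Qt with m≤n⇒m<n∨m≡n s≤t
... | inj₂ refl = ⊥-elim (¬Qs Qt)
... | inj₁ (s≤s s≤t′) with Q? t
...   | no ¬Qt = t , s≤t′ , ≤-refl , ¬Qt , λ y t<y y≤1+t → subst Q (≤-antisym t<y y≤1+t) Qt
...   | yes Qt′ with last-change Q? t s≤t′ ¬Qs Qt′
...     | v , s≤v , v<t , ¬Qv , between = v , s≤v , m<n⇒m<1+n v<t , ¬Qv , between′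
  where
  between′ : ∀ y → v < y → y ≤ suc t → Q y
  between′ y v<y y≤1+t with m≤n⇒m<n∨m≡n y≤1+t
  ... | inj₁ (s≤s y≤t) = between y v<y y≤t
  ... | inj₂ refl      = Qt

first-change : ∀ {Q : ℕ → Set} → (∀ x → Dec (Q x)) → ∀ {t e} → t ≤ e → Q t → ¬ Q e →
               ∃[ v ] (t ≤ v × v < e × ¬ Q (suc v) × (∀ y → t ≤ y → y ≤ v → Q y))
first-change {Q} Q? t≤e Qt ¬Qe with m≤n⇒∃[o]m+o≡n t≤e
... | k , refl = search k _ Qt ¬Qe
  where
  search : ∀ k t → Q t → ¬ Q (t + k) →
           ∃[ v ] (t ≤ v × v < t + k × ¬ Q (suc v) × (∀ y → t ≤ y → y ≤ v → Q y))
  search zero t Qt ¬Qe = ⊥-elim (¬Qe (subst Q (sym (+-identityʳ t)) Qt))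
  search (suc k) t Qt ¬Qe with Q? (suc t)
  ... | no ¬Qt⁺ = t , ≤-refl , m<m+n t (s≤s z≤n) , ¬Qt⁺ ,
                  λ y t≤y y≤t → subst Q (≤-antisym t≤y y≤t) Qt
  ... | yes Qt⁺ with search k (suc t) Qt⁺ (¬Qe ∘ subst Q (sym (+-suc t k)))
  ...   | v , t<v , v<e , ¬Qv , between =
    v , <⇒≤ t<v , subst (v <_) (sym (+-suc t k)) v<e , ¬Qv , between′
    where
    between′ : ∀ y → t ≤ y → y ≤ v → Q y
    between′ y t≤y y≤v with m≤n⇒m<n∨m≡n t≤y
    ... | inj₁ t<y  = between y t<y y≤v
    ... | inj₂ refl = Qt

-- Pebble counts in the subtrees of the children.

total : (Fin n → ℕ → ℕ) → ℕ → ℕ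
total g x = sum (tabulate (λ i → g i x))

term≤total : ∀ (g : Fin n → ℕ → ℕ) i x → g i x ≤ total g x
term≤total g F.zero    x = m≤m+n _ _
term≤total g (F.suc i) x = ≤-trans (term≤total (g ∘ F.suc) i x) (m≤n+m _ _)

count≤total : ∀ (g : Fin n → ℕ → ℕ) x → (∀ i → 1 ≤ g i x) → n ≤ total g x
count≤total {zero}  g x pos = z≤n
count≤total {suc n} g x pos = +-mono-≤ (pos F.zero) (count≤total (g ∘ F.suc) x (pos ∘ F.suc))

childPebbles : (ℕ → Conf d (suc h)) → Fin d → ℕ → ℕ
childPebbles f i x = pebbles (child i (f x))

sum-children : (c : Conf d (suc h)) → sum (map pebbles (proj₂ c)) ≡ sum (tabulate (λ i → pebbles (child i c)))
sum-children (_ , cs) = cong sum (trans (cong (map pebbles) (sym (tabulate∘lookup cs)))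
                                        (sym (tabulate-∘ pebbles (lookup cs))))

occupied⇒1≤cnt : ∀ {p} → p ≢ none → 1 ≤ cnt p
occupied⇒1≤cnt {none}  p≢none = ⊥-elim (p≢none refl)
occupied⇒1≤cnt {black} _      = s≤s z≤n
occupied⇒1≤cnt {white} _      = s≤s z≤n

pebbles≡ : (f : ℕ → Conf d (suc h)) → ∀ x →
           pebbles (f x) ≡ cnt (root (f x)) + total (childPebbles f) x
pebbles≡ f x = cong (cnt (root (f x)) +_) (sum-children (f x))

total≤pebbles : (f : ℕ → Conf d (suc h)) → ∀ x → total (childPebbles f) x ≤ pebbles (f x)
total≤pebbles f x rewrite pebbles≡ f x = m≤n+m _ _

occupied⇒1≤pebbles : (c : Conf d (suc h)) → root c ≢ none → 1 ≤ pebbles c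
occupied⇒1≤pebbles (_ , _) p≢none = ≤-trans (occupied⇒1≤cnt p≢none) (m≤m+n _ _)

occupied⇒total<pebbles : (f : ℕ → Conf d (suc h)) → ∀ x → root (f x) ≢ none →
                         suc (total (childPebbles f) x) ≤ pebbles (f x)
occupied⇒total<pebbles f x occ rewrite pebbles≡ f x = +-monoˡ-≤ _ (occupied⇒1≤cnt occ)

0-pebbles⇒root-none : (c : Conf d (suc h)) → pebbles c ≡ 0 → root c ≡ none
0-pebbles⇒root-none (none , _) _ = refl

0-pebbles⇒child-0 : (f : ℕ → Conf d (suc h)) → ∀ x → pebbles (f x) ≡ 0 → ∀ i → childPebbles f i x ≡ 0
0-pebbles⇒child-0 f x eq i = n≤0⇒n≡0 (subst (childPebbles f i x ≤_) eq
  (≤-trans (term≤total (childPebbles f) i x) (total≤pebbles f x)))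

-- Peaks of the pebble count.

Peak : (ℕ → ℕ) → (s t e P : ℕ) → Set
Peak g s t e P = ∃[ u ] (s ≤ u × u ≤ e × P ≤ g u ×
  (∀ y → u ≤ y → y ≤ t → 1 ≤ g y) × (∀ y → t ≤ y → y ≤ u → 1 ≤ g y))

-- The lower bound in a form fit for induction: it concerns every window of a run between two empty
-- moments, and accepts a root pebble of either colour, since children may be pebbled white. The
-- trees have `suc h` levels.
Peaks : Bool → (d h P : ℕ) → Set
Peaks ws d h P = ∀ (f : ℕ → Conf d (suc h)) → Run ws f → ∀ s t e → s ≤ t → t ≤ e →
  pebbles (f s) ≡ 0 → pebbles (f e) ≡ 0 → root (f t) ≢ none →
  ∃[ u ] (s ≤ u × u ≤ e × P ≤ pebbles (f u))

-- The window is shrunk to the nearest empty moments on both sides of `t`. A peak of at least one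
-- pebble cannot lie at these ends, so only nonempty moments separate it from `t`.
connected-peak : ∀ {P} → Peaks ws d h (suc P) →
  ∀ (f : ℕ → Conf d (suc h)) → Run ws f → ∀ s t e → s ≤ t → t ≤ e →
  pebbles (f s) ≡ 0 → pebbles (f e) ≡ 0 → root (f t) ≢ none →
  Peak (λ x → pebbles (f x)) s t e (suc P)
connected-peak {P = P} peaks f run s t e s≤t t≤e fs≡0 fe≡0 occ
  with last-change (λ x → 1 ≤? pebbles (f x)) t s≤t (λ 1≤fs → 1+n≰n (subst (1 ≤_) fs≡0 1≤fs))
                   (occupied⇒1≤pebbles (f t) occ)
     | first-change (λ x → 1 ≤? pebbles (f x)) t≤e (occupied⇒1≤pebbles (f t) occ)
                   (λ 1≤fe → 1+n≰n (subst (1 ≤_) fe≡0 1≤fe))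
... | s′ , s≤s′ , s′<t , ¬fs′ , left | e′ , t≤e′ , e′<e , ¬fe′ , right
  with peaks f run s′ t (suc e′) (<⇒≤ s′<t) (m≤n⇒m≤1+n t≤e′)
             (n<1⇒n≡0 (≰⇒> ¬fs′)) (n<1⇒n≡0 (≰⇒> ¬fe′)) occ
... | u , s′≤u , u≤e′ , P≤fu = u , ≤-trans s≤s′ s′≤u , ≤-trans u≤e′ e′<e , P≤fu , before , after
  where
  1≤fu : 1 ≤ pebbles (f u)
  1≤fu = ≤-trans (s≤s z≤n) P≤fu
  before : ∀ y → u ≤ y → y ≤ t → 1 ≤ pebbles (f y)
  before y u≤y y≤t with m≤n⇒m<n∨m≡n s′≤u
  ... | inj₁ s′<u = left y (<-≤-trans s′<u u≤y) y≤t
  ... | inj₂ refl = ⊥-elim (¬fs′ 1≤fu)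
  after : ∀ y → t ≤ y → y ≤ u → 1 ≤ pebbles (f y)
  after y t≤y y≤u with m≤n⇒m<n∨m≡n u≤e′
  ... | inj₁ (s≤s u≤e″) = right y t≤y (≤-trans y≤u u≤e″)
  ... | inj₂ refl       = ⊥-elim (¬fe′ 1≤fu)

-- The critical moment, when all children are pebbled.

black≢none : black ≢ none
black≢none ()

white≢none : white ≢ none
white≢none ()

black? : ∀ p → Dec (p ≡ black)
black? none  = no λ ()
black? black = yes refl
black? white = no λ ()

white? : ∀ p → Dec (p ≡ white)
white? none  = no λ ()
white? black = no λ ()
white? white = yes refl

Full : Conf d (suc h) → Set
Full c = ∀ i → occupied (child i c)

turns-black : ∀ {c c′ : Conf d (suc h)} → c ≡ c′ ⊎ Step ws c c′ →
              root c ≢ black → root c′ ≡ black → Full c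
turns-black (inj₁ refl) c≢b c′≡b = ⊥-elim (c≢b c′≡b)
turns-black (inj₂ (atRoot (slide occ _))) _ _ = λ i → lookup⁺ occ i
turns-black (inj₂ (inChild _ _)) c≢b c′≡b = ⊥-elim (c≢b c′≡b)
turns-black (inj₂ (atRoot placeWhite)) _ ()

setWhite-occupied : (c : Conf d h) → occupied (setWhite c)
setWhite-occupied {h = zero}  _ = tt
setWhite-occupied {h = suc h} _ = λ ()

-- A white slide itself pebbles the one missing child, so the children are all pebbled after that
-- move instead of before it.
loses-white : ∀ {c c′ : Conf d (suc h)} → c ≡ c′ ⊎ Step ws c c′ →
              root c ≡ white → root c′ ≢ white → Full c ⊎ (ws ≡ true × Full c′)
loses-white (inj₁ refl) c≡w c′≢w = ⊥-elim (c′≢w c≡w)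
loses-white (inj₂ (inChild _ _)) c≡w c′≢w = ⊥-elim (c′≢w c≡w)
loses-white (inj₂ (atRoot placeWhite)) ()
loses-white (inj₂ (atRoot (slide occ _))) _ _ = inj₁ λ i → lookup⁺ occ i
loses-white {d = d} (inj₂ (atRoot (whiteSlide {cs = cs} ws≡ j others empty))) _ _ = inj₂ (ws≡ , full)
  where
  full : ∀ i → occupied (lookup (cs [ j ]≔ setWhite (lookup cs j)) i)
  full i with i F.≟ j
  ... | yes refl = subst occupied (sym (lookup∘update i cs _)) (setWhite-occupied (lookup cs i))
  ... | no  i≢j  = subst occupied (sym (lookup∘update′ i≢j cs _)) (others i i≢j)

Pebbled : (ℕ → Conf d (suc h)) → ℕ → Set
Pebbled f x = root (f x) ≢ none

-- A black root is traced back to the move that blackened it, a white root forward to the move that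
-- takes the white pebble away; the rules make all children pebbled there. That the root stays
-- pebbled between `v` and `t` matters for binary trees; `ws ≡ true` covers a white slide, which
-- leaves the root bare.
critical : ∀ (f : ℕ → Conf d (suc h)) → Run ws f → ∀ s t e → s ≤ t → t ≤ e →
  pebbles (f s) ≡ 0 → pebbles (f e) ≡ 0 → root (f t) ≢ none →
  ∃[ v ] (s ≤ v × v ≤ e × Full (f v) ×
    ((v ≤ t × (∀ y → v < y → y ≤ t → Pebbled f y)) ⊎
     (t ≤ v × (∀ y → t ≤ y → y ≤ v → Pebbled f y)) ⊎ ws ≡ true))
critical f run s t e s≤t t≤e fs≡0 fe≡0 occ with root (f t) in eq
... | none = ⊥-elim (occ refl)
... | black with last-change (λ x → black? (root (f x))) t s≤t
                   (λ b → black≢none (trans (sym b) (0-pebbles⇒root-none (f s) fs≡0))) eq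
... | v , s≤v , v<t , ¬b , between =
  v , s≤v , ≤-trans (<⇒≤ v<t) t≤e , turns-black (run v) ¬b (between (suc v) ≤-refl v<t) ,
  inj₁ (<⇒≤ v<t , λ y v<y y≤t is-none → black≢none (trans (sym (between y v<y y≤t)) is-none))
critical f run s t e s≤t t≤e fs≡0 fe≡0 occ | white
  with first-change (λ x → white? (root (f x))) t≤e eq
                   (λ w → white≢none (trans (sym w) (0-pebbles⇒root-none (f e) fe≡0)))
... | v , t≤v , v<e , ¬w , between with loses-white (run v) (between v t≤v ≤-refl) ¬w
... | inj₁ full = v , ≤-trans s≤t t≤v , <⇒≤ v<e , full ,
      inj₂ (inj₁ (t≤v , λ y t≤y y≤v is-none → white≢none (trans (sym (between y t≤y y≤v)) is-none)))
... | inj₂ (ws≡ , full) = suc v , ≤-trans s≤t (m≤n⇒m≤1+n t≤v) , v<e , full , inj₂ (inj₂ ws≡)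

-- Peaks on one side of a moment.

-- k + 1 of the functions g i have a peak at or ≼-before v; x is the peak ≼-closest to v.
Side : (_≼_ : Rel ℕ 0ℓ) → (Fin n → ℕ → ℕ) → (s v e P k : ℕ) → Set
Side _≼_ g s v e P k = ∃[ x ] (s ≤ x × x ≤ e × x ≼ v × P + k ≤ total g x ×
  (∀ y → x ≼ y → y ≼ v → suc k ≤ total g y))

-- Indexed by the number of peaks itself, with no claim for 0, so that `extend-side` can start from
-- nothing.
Side? : (_≼_ : Rel ℕ 0ℓ) → (Fin n → ℕ → ℕ) → (s v e P k : ℕ) → Set
Side? _≼_ g s v e P zero    = ⊤
Side? _≼_ g s v e P (suc k) = Side _≼_ g s v e P k

weaken-side : ∀ (_≼_ : Rel ℕ 0ℓ) {s v e P} (g : Fin (suc n) → ℕ → ℕ) k →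
              Side? _≼_ (g ∘ F.suc) s v e P k → Side? _≼_ g s v e P k
weaken-side _≼_ g zero    _ = tt
weaken-side _≼_ g (suc k) (x , s≤x , x≤e , x≼v , big , between) =
  x , s≤x , x≤e , x≼v , ≤-trans big (m≤n+m _ _) ,
  λ y x≼y y≼v → ≤-trans (between y x≼y y≼v) (m≤n+m _ _)

module _ {_≼_ : Rel ℕ 0ℓ} (≼-trans : Transitive _≼_) (≼-total : Total _≼_) {s v e P : ℕ} where

  -- Of the new peak `u` and the old `x`, the one closer to `v` becomes the witness; the functions
  -- with farther peaks still contribute one pebble each there. The order is abstract so that `_≤_`
  -- and `flip _≤_` serve the two sides of `v`.
  extend-side : ∀ (g : Fin (suc n) → ℕ → ℕ) u → s ≤ u → u ≤ e → u ≼ v → P ≤ g F.zero u →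
                (∀ y → u ≼ y → y ≼ v → 1 ≤ g F.zero y) →
                ∀ k → Side? _≼_ (g ∘ F.suc) s v e P k → Side _≼_ g s v e P k
  extend-side g u s≤u u≤e u≼v P≤gu pos zero _ =
    u , s≤u , u≤e , u≼v , +-mono-≤ P≤gu z≤n , λ y u≼y y≼v → +-mono-≤ (pos y u≼y y≼v) z≤n
  extend-side g u s≤u u≤e u≼v P≤gu pos (suc k) (x , s≤x , x≤e , x≼v , big , between) with ≼-total u x
  ... | inj₁ u≼x = x , s≤x , x≤e , x≼v ,
        subst (_≤ total g x) (sym (+-suc P k)) (+-mono-≤ (pos x u≼x x≼v) big) ,
        λ y x≼y y≼v → +-mono-≤ (pos y (≼-trans u≼x x≼y) y≼v) (between y x≼y y≼v)
  ... | inj₂ x≼u = u , s≤u , u≤e , u≼v , +-mono-≤ P≤gu (between u x≼u u≼v) ,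
        λ y u≼y y≼v → +-mono-≤ (pos y u≼y y≼v) (between y (≼-trans x≼u u≼y) y≼v)

split-peaks : ∀ {s v e P} (g : Fin n → ℕ → ℕ) → (∀ i → Peak (g i) s v e P) →
  ∃[ a ] ∃[ b ] (a + b ≡ n × Side? _≤_ g s v e P a × Side? (flip _≤_) g s v e P b)
split-peaks {zero}  g peaks = 0 , 0 , refl , tt , tt
split-peaks {suc n} {v = v} g peaks with split-peaks (g ∘ F.suc) (peaks ∘ F.suc) | peaks F.zero
... | a , b , a+b≡n , left , right | u , s≤u , u≤e , P≤gu , before , after with ≤-total u v
... | inj₁ u≤v = suc a , b , cong suc a+b≡n ,
      extend-side ≤-trans ≤-total g u s≤u u≤e u≤v P≤gu before a left ,
      weaken-side (flip _≤_) g b right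
... | inj₂ v≤u = a , suc b , trans (+-suc a b) (cong suc a+b≡n) ,
      weaken-side _≤_ g a left ,
      extend-side (flip ≤-trans) (flip ≤-total) g u s≤u u≤e v≤u P≤gu
        (λ y y≤u v≤y → after y v≤y y≤u) b right

-- The lower bound for odd degree.

leaf-children-peaks : Peaks ws d 1 d
leaf-children-peaks f run s t e s≤t t≤e fs≡0 fe≡0 occ =
  let v , s≤v , v≤e , full , _ = critical f run s t e s≤t t≤e fs≡0 fe≡0 occ
  in  v , s≤v , v≤e ,
      ≤-trans (count≤total (childPebbles f) v λ i → occupied⇒1≤pebbles (child i (f v)) (full i))
              (total≤pebbles f v)

child-peaks : ∀ {P} → Peaks ws d h (suc P) →
  ∀ (f : ℕ → Conf d (suc (suc h))) → Run ws f → ∀ s v e → s ≤ v → v ≤ e →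
  pebbles (f s) ≡ 0 → pebbles (f e) ≡ 0 → Full (f v) →
  ∀ i → Peak (childPebbles f i) s v e (suc P)
child-peaks peaks f run s v e s≤v v≤e fs≡0 fe≡0 full i =
  connected-peak peaks (child i ∘ f) (child-run run i) s v e s≤v v≤e
    (0-pebbles⇒child-0 f s fs≡0 i) (0-pebbles⇒child-0 f e fe≡0 i) (full i)

majority : ∀ a b m → a + b ≡ m + suc m → m < a ⊎ m < b
majority a b m a+b≡ with suc m ≤? a
... | yes m<a = inj₁ m<a
... | no  m≮a = inj₂ (+-cancelˡ-≤ m (suc m) b (≤-trans (≤-reflexive (sym a+b≡)) (+-monoˡ-≤ b (≮⇒≥ m≮a))))

side-total : ∀ (_≼_ : Rel ℕ 0ℓ) (g : Fin n → ℕ → ℕ) {s v e P m} a → m < a → Side? _≼_ g s v e P a →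
             ∃[ u ] (s ≤ u × u ≤ e × P + m ≤ total g u)
side-total _≼_ g {P = P} (suc k) (s≤s m≤k) (x , s≤x , x≤e , _ , big , _) =
  x , s≤x , x≤e , ≤-trans (+-monoʳ-≤ P m≤k) big

odd-peaks-suc : ∀ {P} m → d ≡ m + suc m → Peaks ws d h (suc P) → Peaks ws d (suc h) (suc P + m)
odd-peaks-suc {P = P} m d≡ peaks f run s t e s≤t t≤e fs≡0 fe≡0 occ =
  let v , s≤v , v≤e , full , _ = critical f run s t e s≤t t≤e fs≡0 fe≡0 occ
      u , s≤u , u≤e , big = large-side v (split-peaks (childPebbles f)
                              (child-peaks peaks f run s v e s≤v v≤e fs≡0 fe≡0 full))
  in  u , s≤u , u≤e , ≤-trans big (total≤pebbles f u)
  where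
  large-side : ∀ v → ∃[ a ] ∃[ b ] (a + b ≡ _ × Side? _≤_ (childPebbles f) s v e (suc P) a ×
                                     Side? (flip _≤_) (childPebbles f) s v e (suc P) b) →
               ∃[ u ] (s ≤ u × u ≤ e × suc P + m ≤ total (childPebbles f) u)
  large-side v (a , b , a+b≡d , left , right) with majority a b m (trans a+b≡d d≡)
  ... | inj₁ m<a = side-total _≤_ (childPebbles f) a m<a left
  ... | inj₂ m<b = side-total (flip _≤_) (childPebbles f) b m<b right

-- The tree has `suc (suc k)` levels; at two levels the `d` pebbled leaves are exactly the
-- `suc (m * 2)` pebbles required.
odd-peaks : ∀ m k → d ≡ m + suc m → Peaks ws d (suc k) (suc (m * suc (suc k)))
odd-peaks {d} {ws} m zero d≡ = subst (Peaks ws d 1) (trans d≡ (lemma m)) leaf-children-peaks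
  where
  lemma : ∀ m → m + suc m ≡ suc (m * 2)
  lemma = solve-∀
odd-peaks {d} {ws} m (suc k) d≡ = subst (Peaks ws d (suc (suc k))) (lemma m k) (odd-peaks-suc m d≡ (odd-peaks m k d≡))
  where
  lemma : ∀ m k → suc (m * suc (suc k)) + m ≡ suc (m * suc (suc (suc k)))
  lemma = solve-∀

-- The lower bound for binary trees.

-- Unless P is exceeded, the peak of height P can be chosen no later than t: this is
-- what lets the binary tree gain one pebble over two levels.
EarlyPeak : (ℕ → ℕ) → (s t e P : ℕ) → Set
EarlyPeak g s t e P = ∃[ u ] (s ≤ u × u ≤ e × suc P ≤ g u) ⊎
  ∃[ x ] (s ≤ x × x ≤ e × x ≤ t × P ≤ g x × (∀ y → x ≤ y → y ≤ t → 1 ≤ g y))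

EarlyPeaks : (d h P : ℕ) → Set
EarlyPeaks d h P = ∀ (f : ℕ → Conf d (suc h)) → Run false f → ∀ s t e → s ≤ t → t ≤ e →
  pebbles (f s) ≡ 0 → pebbles (f e) ≡ 0 → root (f t) ≢ none →
  EarlyPeak (λ x → pebbles (f x)) s t e P

-- A child's peak before the critical moment `v` yields an early peak of the whole tree. If `v ≤ t`,
-- the root pebble keeps the tree nonempty after `v` up to `t`. If `t ≤ v` and the peak is not
-- before `t`, the root pebble counts on top of it and `P` is exceeded; otherwise the peak is early
-- already.
early-peak : ∀ (f : ℕ → Conf d (suc h)) {s v t e P} →
  (v ≤ t × (∀ y → v < y → y ≤ t → Pebbled f y)) ⊎
  (t ≤ v × (∀ y → t ≤ y → y ≤ v → Pebbled f y)) ⊎ false ≡ true →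
  Side _≤_ (childPebbles f) s v e P 0 → EarlyPeak (λ x → pebbles (f x)) s t e P
early-peak f {v = v} {t} {P = P} (inj₁ (v≤t , held)) (x , s≤x , x≤e , x≤v , big , between) =
  inj₂ (x , s≤x , x≤e , ≤-trans x≤v v≤t ,
        ≤-trans (m≤m+n P 0) (≤-trans big (total≤pebbles f x)) , positive)
  where
  positive : ∀ y → x ≤ y → y ≤ t → 1 ≤ pebbles (f y)
  positive y x≤y y≤t with ≤-<-connex y v
  ... | inj₁ y≤v = ≤-trans (between y x≤y y≤v) (total≤pebbles f y)
  ... | inj₂ v<y = occupied⇒1≤pebbles (f y) (held y v<y y≤t)
early-peak f {t = t} {P = P} (inj₂ (inj₁ (t≤v , held))) (x , s≤x , x≤e , x≤v , big , between)
  with ≤-total t x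
... | inj₁ t≤x = inj₁ (x , s≤x , x≤e , ≤-trans (s≤s (≤-trans (m≤m+n P 0) big))
                                               (occupied⇒total<pebbles f x (held x t≤x x≤v)))
... | inj₂ x≤t = inj₂ (x , s≤x , x≤e , x≤t , ≤-trans (m≤m+n P 0) (≤-trans big (total≤pebbles f x)) ,
                       λ y x≤y y≤t → ≤-trans (between y x≤y (≤-trans y≤t t≤v)) (total≤pebbles f y))

binary-leaf-early : EarlyPeaks 2 1 2
binary-leaf-early f run s t e s≤t t≤e fs≡0 fe≡0 occ =
  let v , s≤v , v≤e , full , held = critical f run s t e s≤t t≤e fs≡0 fe≡0 occ
      two≤ = count≤total (childPebbles f) v λ i → occupied⇒1≤pebbles (child i (f v)) (full i)
  -- The critical moment itself is taken as the peak, so the stretch from the peak to `v` is a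
  -- single moment.
  in  early-peak f held (v , s≤v , v≤e , ≤-refl , two≤ ,
        λ y v≤y y≤v → subst (λ x → 1 ≤ total (childPebbles f) x) (≤-antisym v≤y y≤v)
                            (≤-trans (s≤s z≤n) two≤))

-- If both children peak on the same side of the critical moment, then at the closer peak the other
-- child still holds a pebble and the number is exceeded. Otherwise one peak lies on each side, and
-- the left one goes to `early-peak`.
binary-early : ∀ {P} → Peaks false 2 h (suc P) → EarlyPeaks 2 (suc h) (suc P)
binary-early {P = P} peaks f run s t e s≤t t≤e fs≡0 fe≡0 occ =
  let v , s≤v , v≤e , full , held = critical f run s t e s≤t t≤e fs≡0 fe≡0 occ
      a , b , a+b≡2 , left , right = split-peaks g (child-peaks peaks f run s v e s≤v v≤e fs≡0 fe≡0 full)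
  in  distribute v held a b a+b≡2 left right
  where
  g = childPebbles f
  Early = EarlyPeak (λ x → pebbles (f x)) s t e (suc P)
  both : ∀ {_≼_ : Rel ℕ 0ℓ} {v} → Side _≼_ g s v e (suc P) 1 → Early
  both (x , s≤x , x≤e , _ , big , _) =
    inj₁ (x , s≤x , x≤e , ≤-trans (≤-reflexive (+-comm 1 (suc P))) (≤-trans big (total≤pebbles f x)))
  distribute : ∀ v → (v ≤ t × (∀ y → v < y → y ≤ t → Pebbled f y)) ⊎
    (t ≤ v × (∀ y → t ≤ y → y ≤ v → Pebbled f y)) ⊎ false ≡ true →
    ∀ a b → a + b ≡ 2 → Side? _≤_ g s v e (suc P) a → Side? (flip _≤_) g s v e (suc P) b → Early
  distribute v held 0 .2 refl _ right = both {flip _≤_} right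
  distribute v held 1 .1 refl left _  = early-peak f held left
  distribute v held 2 .0 refl left _  = both {_≤_} left

-- Unless one child alone exceeds `P`, both children peak no later than the critical moment, and at
-- the later peak the other child still holds a pebble.
binary-peaks-suc : ∀ {P} → EarlyPeaks 2 h P → Peaks false 2 (suc h) (suc P)
binary-peaks-suc {P = P} early f run s t e s≤t t≤e fs≡0 fe≡0 occ =
  let v , s≤v , v≤e , full , _ = critical f run s t e s≤t t≤e fs≡0 fe≡0 occ
      child-early = λ i → early (child i ∘ f) (child-run run i) s v e s≤v v≤e
        (0-pebbles⇒child-0 f s fs≡0 i) (0-pebbles⇒child-0 f e fe≡0 i) (full i)
      u , s≤u , u≤e , big = combine v (child-early F.zero) (child-early (F.suc F.zero))
  in  u , s≤u , u≤e , ≤-trans big (total≤pebbles f u)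
  where
  g = childPebbles f
  combine : ∀ v → EarlyPeak (g F.zero) s v e P → EarlyPeak (g (F.suc F.zero)) s v e P →
            ∃[ u ] (s ≤ u × u ≤ e × suc P ≤ total g u)
  combine v (inj₁ (u , s≤u , u≤e , big)) _ =
    u , s≤u , u≤e , ≤-trans big (term≤total g F.zero u)
  combine v _ (inj₁ (u , s≤u , u≤e , big)) =
    u , s≤u , u≤e , ≤-trans big (term≤total g (F.suc F.zero) u)
  combine v (inj₂ (x , s≤x , x≤e , x≤v , P≤x , pos-x)) (inj₂ (y , s≤y , y≤e , y≤v , P≤y , pos-y)) =
    let z , s≤z , z≤e , _ , big , _ =
          extend-side ≤-trans ≤-total g x s≤x x≤e x≤v P≤x pos-x 1
            (extend-side ≤-trans ≤-total (g ∘ F.suc) y s≤y y≤e y≤v P≤y pos-y 0 tt)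
    in  z , s≤z , z≤e , subst (_≤ total g z) (+-comm P 1) big

-- Every second level gains a pebble: `binary-early` only secures an early peak, and
-- `binary-peaks-suc` turns it into one pebble more.
binary-peaks : ∀ k → Peaks false 2 (suc k) (suc (suc ⌈ k /2⌉))
binary-peaks 0             = leaf-children-peaks
binary-peaks 1             = binary-peaks-suc binary-leaf-early
binary-peaks (suc (suc k)) = binary-peaks-suc (binary-early (binary-peaks k))

-- Pebblings as runs.

-- The last configuration is repeated forever, which makes a finite sequence a function of all
-- moments.
clamp : ∀ {A : Set} n → (Fin (suc n) → A) → ℕ → A
clamp zero    s t       = s F.zero
clamp (suc n) s zero    = s F.zero
clamp (suc n) s (suc t) = clamp n (s ∘ F.suc) t

clamp-∃ : ∀ {A : Set} n (s : Fin (suc n) → A) t → ∃[ i ] clamp n s t ≡ s i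
clamp-∃ zero    s t       = F.zero , refl
clamp-∃ (suc n) s zero    = F.zero , refl
clamp-∃ (suc n) s (suc t) with clamp-∃ n (s ∘ F.suc) t
... | i , eq = F.suc i , eq

clamp-toℕ : ∀ {A : Set} n (s : Fin (suc n) → A) i → clamp n s (toℕ i) ≡ s i
clamp-toℕ zero    s F.zero    = refl
clamp-toℕ (suc n) s F.zero    = refl
clamp-toℕ (suc n) s (F.suc i) = clamp-toℕ n (s ∘ F.suc) i

clamp-run : ∀ n (s : Fin (suc n) → Conf d h) →
            (∀ i → Step ws (s (inject₁ i)) (s (F.suc i))) → Run ws (clamp n s)
clamp-run zero          s steps t       = inj₁ refl
clamp-run (suc zero)    s steps zero    = inj₂ (steps F.zero)
clamp-run (suc (suc n)) s steps zero    = inj₂ (steps F.zero)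
clamp-run (suc n)       s steps (suc t) = clamp-run n (s ∘ F.suc) (steps ∘ F.suc) t

sum-replicate-0 : ∀ n → sum (replicate n 0) ≡ 0
sum-replicate-0 zero    = refl
sum-replicate-0 (suc n) = sum-replicate-0 n

pebbles-empty : ∀ d h → pebbles (emptyConf {d} {h}) ≡ 0
pebbles-empty d zero    = refl
pebbles-empty d (suc h) = trans (cong sum (map-replicate pebbles (emptyConf {d} {h}) d))
  (trans (cong (sum ∘ replicate d) (pebbles-empty d h)) (sum-replicate-0 d))

peaks⇒lower-bound : ∀ {P p} → Peaks ws d h P → Pebbling ws d (suc h) p → P ≤ p
peaks⇒lower-bound {d = d} {h} {P} {p} peaks π = conclude
  (peaks f (clamp-run len seq steps) 0 (toℕ hit) len z≤n (Fₚ.toℕ≤pred[n] hit) at-start at-finish at-hit)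
  where
  open Pebbling π renaming (n to len)
  f = clamp len seq
  hit = proj₁ rootHit
  at-start : pebbles (f 0) ≡ 0
  at-start = trans (cong pebbles (trans (clamp-toℕ len seq F.zero) start)) (pebbles-empty d (suc h))
  at-finish : pebbles (f len) ≡ 0
  at-finish = trans (cong pebbles (trans (cong f (sym (Fₚ.toℕ-fromℕ len)))
    (trans (clamp-toℕ len seq (fromℕ len)) finish))) (pebbles-empty d (suc h))
  at-hit : root (f (toℕ hit)) ≢ none
  at-hit eq = black≢none (trans (sym (proj₂ rootHit)) (trans (cong root (sym (clamp-toℕ len seq hit))) eq))
  conclude : ∃[ u ] (0 ≤ u × u ≤ len × P ≤ pebbles (f u)) → P ≤ p
  conclude (u , _ , _ , P≤fu) with clamp-∃ len seq u
  ... | i , eq = ≤-trans P≤fu (subst (λ c → pebbles c ≤ p) (sym eq) (bounded i))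

-- Upper bound

data Path {A : Set} (_⟶_ : A → A → Set) (size : A → ℕ) (N : ℕ) : A → A → Set where
  stop : ∀ {c} → size c ≤ N → Path _⟶_ size N c c
  move : ∀ {c c′ c″} → size c ≤ N → c ⟶ c′ → Path _⟶_ size N c′ c″ → Path _⟶_ size N c c″

infixr 5 _▷_
_▷_ : ∀ {A : Set} {_⟶_ : A → A → Set} {size N c c′ c″} →
      Path _⟶_ size N c c′ → Path _⟶_ size N c′ c″ → Path _⟶_ size N c c″
stop _      ▷ q = q
move ≤N r p ▷ q = move ≤N r (p ▷ q)

map-path : ∀ {A B : Set} {_⟶_ : A → A → Set} {_⟶′_ : B → B → Set} {size size′ N M} (F : A → B) →
  (∀ {c c′} → c ⟶ c′ → F c ⟶′ F c′) → (∀ c → size c ≤ N → size′ (F c) ≤ M) →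
  ∀ {c c′} → Path _⟶_ size N c c′ → Path _⟶′_ size′ M (F c) (F c′)
map-path F F-step F-size (stop ≤N)     = stop (F-size _ ≤N)
map-path F F-step F-size (move ≤N r p) = move (F-size _ ≤N) (F-step r) (map-path F F-step F-size p)

TreePath : ℕ → Conf d h → Conf d h → Set
TreePath {d} {h} = Path (Step false {d} {h}) pebbles

-- Any length is allowed, so that a forest can be cut by `_++_` and treated in pieces; `forest-step`
-- recovers the single update required by `inChild`.
data ForestStep {d h : ℕ} : ∀ {n} → Vec (Conf d h) n → Vec (Conf d h) n → Set where
  here  : ∀ {n c c′} {cs : Vec (Conf d h) n} → Step false c c′ → ForestStep (c ∷ cs) (c′ ∷ cs)
  there : ∀ {n c} {cs cs′ : Vec (Conf d h) n} → ForestStep cs cs′ → ForestStep (c ∷ cs) (c ∷ cs′)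

weight : Vec (Conf d h) n → ℕ
weight cs = sum (map pebbles cs)

ForestPath : ℕ → Vec (Conf d h) n → Vec (Conf d h) n → Set
ForestPath {d} {h} {n} = Path (ForestStep {d} {h} {n}) weight

weight-++ : ∀ {k} (xs : Vec (Conf d h) k) (ys : Vec (Conf d h) n) →
            weight (xs ++ ys) ≡ weight xs + weight ys
weight-++ xs ys = trans (cong sum (map-++ pebbles xs ys)) (sum-++ (map pebbles xs))

forest-step : {cs cs′ : Vec (Conf d h) n} → ForestStep cs cs′ →
              ∃[ i ] ∃[ c′ ] (Step false (lookup cs i) c′ × cs′ ≡ cs [ i ]≔ c′)
forest-step (here s) = F.zero , _ , s , refl
forest-step (there s) with forest-step s
... | i , c′ , s′ , refl = F.suc i , c′ , s′ , refl

forest⇒tree : ∀ {p} {cs cs′ : Vec (Conf d h) d} → ForestStep cs cs′ → Step false {h = suc h} (p , cs) (p , cs′)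
forest⇒tree s with forest-step s
... | i , _ , s′ , refl = inChild i s′

under-root : ∀ p {N M} {cs cs′ : Vec (Conf d h) d} → cnt p + N ≤ M →
             ForestPath N cs cs′ → TreePath {d} {suc h} M (p , cs) (p , cs′)
under-root p ≤M = map-path (p ,_) forest⇒tree λ _ ≤N → ≤-trans (+-monoʳ-≤ (cnt p) ≤N) ≤M

on-head : ∀ {N M} {c c′ : Conf d h} (cs : Vec (Conf d h) n) → N + weight cs ≤ M →
          TreePath N c c′ → ForestPath M (c ∷ cs) (c′ ∷ cs)
on-head cs ≤M = map-path (_∷ cs) here λ _ ≤N → ≤-trans (+-monoˡ-≤ (weight cs) ≤N) ≤M

on-right : ∀ {k N M} (xs : Vec (Conf d h) k) {cs cs′ : Vec (Conf d h) n} → weight xs + N ≤ M →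
           ForestPath N cs cs′ → ForestPath M (xs ++ cs) (xs ++ cs′)
on-right {d} {h} {n} xs ≤M = map-path (xs ++_) (there* xs) λ cs ≤N →
  ≤-trans (≤-reflexive (weight-++ xs cs)) (≤-trans (+-monoʳ-≤ (weight xs) ≤N) ≤M)
  where
  there* : ∀ {k} (xs : Vec (Conf d h) k) {cs cs′ : Vec (Conf d h) n} →
           ForestStep cs cs′ → ForestStep (xs ++ cs) (xs ++ cs′)
  there* []       s = s
  there* (_ ∷ xs) s = there (there* xs s)

on-left : ∀ {k N M} {xs xs′ : Vec (Conf d h) k} (cs : Vec (Conf d h) n) → N + weight cs ≤ M →
          ForestPath N xs xs′ → ForestPath M (xs ++ cs) (xs′ ++ cs)
on-left {d} {h} cs ≤M = map-path (_++ cs) left λ xs ≤N →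
  ≤-trans (≤-reflexive (weight-++ xs cs)) (≤-trans (+-monoˡ-≤ (weight cs) ≤N) ≤M)
  where
  left : ∀ {k} {xs xs′ : Vec (Conf d h) k} → ForestStep xs xs′ → ForestStep (xs ++ cs) (xs′ ++ cs)
  left (here s)  = here s
  left (there s) = there (left s)

-- Blackening, whitening and clearing a block of siblings.

weight-replicate : ∀ {c : Conf d h} {x} n → pebbles c ≡ x → weight (replicate n c) ≡ n * x
weight-replicate zero    eq = refl
weight-replicate (suc n) eq = cong₂ _+_ eq (weight-replicate n eq)

weight-empties : ∀ {d h} n → weight (replicate n (emptyConf {d} {h})) ≡ 0
weight-empties {d} {h} n = trans (weight-replicate n (pebbles-empty d h)) (*-zeroʳ n)

only : Peb → Conf d (suc h)
only {d} p = p , replicate d emptyConf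

weight-only : ∀ {d h} p n → cnt p ≡ 1 → weight (replicate n (only {d} {h} p)) ≡ n
weight-only {d} {h} p n eq = trans (weight-replicate n one) (*-identityʳ n)
  where
  one : pebbles (only {d} {h} p) ≡ 1
  one = cong₂ _+_ eq (weight-empties {d} {h} d)

-- The last tree is the most expensive: it needs `suc a` pebbles beside the black ones already left
-- on all the others.
blacken : ∀ {a} k → TreePath (suc a) (emptyConf {d} {suc h}) (only black) →
          ForestPath (a + k) (replicate k (emptyConf {d} {suc h})) (replicate k (only black))
blacken zero    p = stop z≤n
blacken {d} {h} {a} (suc k) p =
  on-head (replicate k emptyConf) (≤-trans (≤-reflexive (cong (suc a +_) (weight-empties {d} {suc h} k)))
    (≤-trans (≤-reflexive (+-comm (suc a) 0)) (≤-trans (m≤m+n (suc a) k) (≤-reflexive (sym (+-suc a k)))))) p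
  ▷ on-right (only black ∷ []) (≤-reflexive (trans (cong (_+ (a + k)) (weight-only {d} {h} black 1 refl)) (sym (+-suc a k))))
      (blacken k p)

whiten : ∀ l → ForestPath l (replicate l (emptyConf {d} {suc h})) (replicate l (only white))
whiten zero = stop z≤n
whiten {d} {h} (suc l) =
  move (≤-trans (≤-reflexive (weight-empties {d} {suc h} (suc l))) z≤n) (here (atRoot placeWhite))
    (on-right (only white ∷ []) (≤-reflexive (cong (_+ l) (weight-only {d} {h} white 1 refl))) (whiten l))

-- The first tree is the most expensive: it is cleared while all the other white pebbles still
-- stand.
unwhiten : ∀ {a} l → TreePath (suc a) (only white) (emptyConf {d} {suc h}) →
           ForestPath (a + l) (replicate l (only white)) (replicate l (emptyConf {d} {suc h}))
unwhiten zero    p = stop z≤n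
unwhiten {d} {h} {a} (suc l) p =
  on-head (replicate l (only white)) (≤-reflexive (trans (cong (suc a +_) (weight-only {d} {h} white l refl)) (sym (+-suc a l)))) p
  ▷ on-right (emptyConf ∷ []) (≤-trans (≤-reflexive (cong (_+ (a + l)) (weight-empties {d} {suc h} 1)))
                                      (+-monoʳ-≤ a (n≤1+n l)))
      (unwhiten l p)

-- Cores and their composition.

-- A way to pebble all the children of a root (a pebbles suffice), such that once the black
-- ones have been slid off the remaining pebbles can be cleared (b suffice).  Right
-- after the slide there are at most x pebbles, counting the one on the root.
record Core (d h a b x : ℕ) : Set where
  field
    crit     : Vec (Conf d h) d
    up       : ForestPath a (replicate d emptyConf) crit
    occ      : All occupied crit
    down     : ForestPath b (map unblack crit) (replicate d emptyConf)
    residual : suc (weight (map unblack crit)) ≤ x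

open Core

endpoint-size : ∀ {A : Set} {_⟶_ : A → A → Set} {size N c c′} → Path _⟶_ size N c c′ → size c′ ≤ N
endpoint-size (stop ≤N)    = ≤N
endpoint-size (move _ _ p) = endpoint-size p

core-reach : ∀ {a b x N} (C : Core d h a b x) → a ≤ N → x ≤ N →
             TreePath {d} {suc h} N emptyConf (black , map unblack (crit C))
core-reach C a≤N x≤N =
  under-root none a≤N (up C)
  ▷ move (≤-trans (endpoint-size (up C)) a≤N) (atRoot (slide (occ C) none→black))
      (stop (≤-trans (residual C) x≤N))

-- The black root pebble is present only while the children are cleared, so only `b` is charged for
-- it. In `core-white` the root pebble weighs on the way up instead, and `a` is charged.
core-black : ∀ {a b x N} → Core d h a b x → a ≤ N → suc b ≤ N →
             TreePath {d} {suc h} N emptyConf (only black)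
core-black C a≤N b<N =
  under-root none a≤N (up C)
  ▷ move (≤-trans (endpoint-size (up C)) a≤N) (atRoot (slide (occ C) none→black))
      (under-root black b<N (down C))

core-white : ∀ {a b x N} → Core d h a b x → suc a ≤ N → b ≤ N →
             TreePath {d} {suc h} N (only white) emptyConf
core-white C a<N b≤N =
  under-root white a<N (up C)
  ▷ move (≤-trans (s≤s (endpoint-size (up C))) a<N) (atRoot (slide (occ C) white→none))
      (under-root none b≤N (down C))

replicate-++ : ∀ {A : Set} k l (x : A) → replicate k x ++ replicate l x ≡ replicate (k + l) x
replicate-++ zero    l x = refl
replicate-++ (suc k) l x = cong (x ∷_) (replicate-++ k l x)

all-replicate : ∀ {A : Set} {P : A → Set} {x} n → P x → All P (replicate n x)
all-replicate zero    px = []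
all-replicate (suc n) px = px ∷ all-replicate n px

-- Blacken k children, pebble the next one by the main core, put white pebbles on
-- the remaining l; slide; then clear the next child and finally the l white ones.
core-suc : ∀ {a b x a₁ b₁ x₁ a₂ b₂ x₂ A B X} k l α β → k + suc l ≡ d →
  Core d h a b x → Core d h a₁ b₁ x₁ → Core d h a₂ b₂ x₂ →
  a₁ ≤ suc α → b₁ ≤ α → a₂ ≤ β → b₂ ≤ suc β →
  k + a ≤ A → α + k ≤ A → k + (x + l) ≤ A →
  b + l ≤ B → β + l ≤ B →
  x + l ≤ X → Core d (suc h) A B X
core-suc {h = h} {a} {b} {x} {A = A} {B} {X} k l α β refl C C₁ C₂ a₁≤ b₁≤ a₂≤ b₂≤ ka≤ αk≤ kxl≤ bl≤ βl≤ xl≤ = record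
  { crit     = target
  ; up       = subst (λ z → ForestPath A z target) (replicate-++ k (suc l) E) rise
  ; occ      = ++⁺ (all-replicate k λ ()) ((λ ()) ∷ all-replicate l λ ())
  ; down     = subst₂ (ForestPath B) (sym unblacked) (replicate-++ k (suc l) E) fall
  ; residual = ≤-trans (≤-trans (≤-reflexive (cong (suc ∘ weight) unblacked)) rest≤) xl≤
  }
  where
  d′ = k + suc l
  E Bl Wh : Conf d′ (suc h)
  E  = emptyConf
  Bl = only black
  Wh = only white
  us = map unblack (crit C)
  target rest : Vec (Conf d′ (suc h)) d′
  target = replicate k Bl ++ (black , us) ∷ replicate l Wh
  rest   = replicate k E ++ (none , us) ∷ replicate l Wh
  wE : ∀ n → weight (replicate n E) ≡ 0
  wE = weight-empties {d′} {suc h}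
  wBl : ∀ n → weight (replicate n Bl) ≡ n
  wBl n = weight-only {d′} {h} black n refl
  wWh : ∀ n → weight (replicate n Wh) ≡ n
  wWh n = weight-only {d′} {h} white n refl
  unblacked : map unblack target ≡ rest
  unblacked = trans (map-++ unblack (replicate k Bl) _)
    (cong₂ (λ xs ys → xs ++ (none , us) ∷ ys) (map-replicate unblack Bl k) (map-replicate unblack Wh l))
  rest≤ : suc (weight rest) ≤ x + l
  rest≤ = ≤-trans (s≤s (≤-reflexive (trans (weight-++ (replicate k E) _)
    (cong₂ _+_ (wE k) (cong (weight us +_) (wWh l)))))) (+-monoˡ-≤ l (residual C))
  rise : ForestPath A (replicate k E ++ E ∷ replicate l E) target
  rise = on-left (replicate (suc l) E)
           (≤-trans (≤-reflexive (trans (cong (α + k +_) (wE (suc l))) (+-identityʳ _))) αk≤)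
           (blacken k (core-black C₁ a₁≤ (s≤s b₁≤)))
       -- The main child is bounded by `a` up to its own slide and by `x` right after it; both must
       -- fit beside the `k` black pebbles.
       ▷ on-right (replicate k Bl) (≤-trans (≤-reflexive (cong (_+ (a ⊔ x)) (wBl k))) max≤)
           (on-head (replicate l E) (≤-reflexive (trans (cong (a ⊔ x +_) (wE l)) (+-identityʳ _)))
             (core-reach C (m≤m⊔n a x) (m≤n⊔m a x)))
       ▷ on-right (replicate k Bl) (≤-trans (≤-reflexive (cong (_+ (x + l)) (wBl k))) kxl≤)
           (on-right ((black , us) ∷ []) (+-monoˡ-≤ l (≤-trans (≤-reflexive (+-identityʳ _)) (residual C)))
             (whiten l))
    where
    max≤ : k + (a ⊔ x) ≤ A
    max≤ = ≤-trans (≤-reflexive (+-distribˡ-⊔ k a x))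
                   (⊔-lub ka≤ (≤-trans (+-monoʳ-≤ k (m≤m+n x l)) kxl≤))
  -- The slide has taken away the black pebbles of the children, so only the `l` white ones add to
  -- the cost of clearing.
  fall : ForestPath B rest (replicate k E ++ E ∷ replicate l E)
  fall = on-right (replicate k E) (≤-trans (≤-reflexive (cong (_+ (b + l)) (wE k))) bl≤)
           (on-head (replicate l Wh) (≤-reflexive (cong (b +_) (wWh l))) (under-root none ≤-refl (down C)))
       ▷ on-right (replicate k E) (≤-trans (≤-reflexive (cong (_+ (β + l)) (wE k))) βl≤)
           (on-right (E ∷ []) (≤-reflexive (cong (_+ (β + l)) (wE 1)))
             (unwhiten l (core-white C₂ (s≤s a₂≤) b₂≤)))

-- The children of a leaf are trees without nodes; the 1 is the pebble on the leaf itself.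
core-leaf : Core d 0 0 0 1
core-leaf {d} = record
  { crit     = leaves
  ; up       = stop (≤-reflexive w≡0)
  ; occ      = all-replicate d tt
  ; down     = subst (λ cs → ForestPath {d} {0} 0 cs leaves) (sym unblack≡) (stop (≤-reflexive w≡0))
  ; residual = s≤s (≤-reflexive (trans (cong (weight {d} {0}) unblack≡) w≡0))
  }
  where
  leaves : Vec (Conf d 0) d
  leaves = replicate d (emptyConf {d} {0})
  w≡0 : weight {d} {0} leaves ≡ 0
  w≡0 = weight-empties {d} {0} d
  unblack≡ : map (unblack {d} {0}) leaves ≡ leaves
  unblack≡ = map-replicate (unblack {d} {0}) (emptyConf {d} {0}) d

core-mono : ∀ {a b x A B X} → a ≤ A → b ≤ B → x ≤ X → Core d h a b x → Core d h A B X
core-mono a≤ b≤ x≤ C = record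
  { crit     = crit C
  ; up       = map-path (λ cs → cs) (λ s → s) (λ _ ≤a → ≤-trans ≤a a≤) (up C)
  ; occ      = occ C
  ; down     = map-path (λ cs → cs) (λ s → s) (λ _ ≤b → ≤-trans ≤b b≤) (down C)
  ; residual = ≤-trans (residual C) x≤
  }

-- Reading a pebbling off a path.

module _ {A : Set} {_⟶_ : A → A → Set} {size : A → ℕ} {N : ℕ} where

  length : ∀ {c c′} → Path _⟶_ size N c c′ → ℕ
  length (stop _)     = 0
  length (move _ _ p) = suc (length p)

  node : ∀ {c c′} (p : Path _⟶_ size N c c′) → Fin (suc (length p)) → A
  node {c} _          F.zero    = c
  node (move _ _ p)   (F.suc i) = node p i

  node-last : ∀ {c c′} (p : Path _⟶_ size N c c′) → node p (fromℕ (length p)) ≡ c′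
  node-last (stop _)     = refl
  node-last (move _ _ p) = node-last p

  node-step : ∀ {c c′} (p : Path _⟶_ size N c c′) i → node p (inject₁ i) ⟶ node p (F.suc i)
  node-step (move _ r p) F.zero    = r
  node-step (move _ _ p) (F.suc i) = node-step p i

  node-size : ∀ {c c′} (p : Path _⟶_ size N c c′) i → size (node p i) ≤ N
  node-size (stop ≤N)     F.zero    = ≤N
  node-size (move ≤N _ _) F.zero    = ≤N
  node-size (move _ _ p)  (F.suc i) = node-size p i

  node-▷ : ∀ {c c′ c″} (p : Path _⟶_ size N c c′) (q : Path _⟶_ size N c′ c″) →
           ∃[ i ] node (p ▷ q) i ≡ c′
  node-▷ (stop _)     q = F.zero , refl
  node-▷ (move _ _ p) q with node-▷ p q
  ... | i , eq = F.suc i , eq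

core-pebbling : ∀ {a b x N} → a ≤ N → b ≤ N → x ≤ N → Core d h a b x → Pebbling false d (suc h) N
core-pebbling {d} {h} {N = N} a≤N b≤N x≤N C = record
  { n       = length path
  ; seq     = node path
  ; start   = refl
  ; finish  = node-last path
  ; steps   = node-step path
  ; rootHit = proj₁ visit , cong root (proj₂ visit)
  ; bounded = node-size path
  }
  where
  reach : TreePath {d} {suc h} N emptyConf (black , map unblack (crit C))
  reach = core-reach C a≤N x≤N
  leave : TreePath {d} {suc h} N (black , map unblack (crit C)) emptyConf
  -- The root pebble goes first, so that clearing the rest costs only `b`.
  leave = move (endpoint-size reach) (atRoot removeBlack) (under-root none b≤N (down C))
  path  = reach ▷ leave
  visit = node-▷ reach leave

-- The upper bound for odd degree.

-- With `m` black and `m` white siblings each phase costs `m` more per level. All of them fit around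
-- the main child because the bound right after its slide is `m` below the bound of its phases.
odd-core : ∀ m h → d ≡ m + suc m → Core d h (suc (m * suc h)) (suc (m * suc h)) (suc (m * h))
odd-core m zero    d≡ = core-mono z≤n z≤n (s≤s z≤n) core-leaf
odd-core m (suc h) d≡ = core-suc m m p p (sym d≡) C C C (n≤1+n p) ≤-refl ≤-refl (n≤1+n p)
  (≤-reflexive (k+a m h)) (≤-reflexive (a+k m h)) (≤-reflexive (k+x+l m h))
  (≤-reflexive (a+k m h)) (≤-reflexive (a+k m h)) (≤-reflexive (x+l m h))
  where
  p = suc (m * suc h)
  C = odd-core m h d≡
  k+a : ∀ m h → m + suc (m * suc h) ≡ suc (m * suc (suc h))
  k+a = solve-∀
  a+k : ∀ m h → suc (m * suc h) + m ≡ suc (m * suc (suc h))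
  a+k = solve-∀
  k+x+l : ∀ m h → m + (suc (m * h) + m) ≡ suc (m * suc (suc h))
  k+x+l = solve-∀
  x+l : ∀ m h → suc (m * h) + m ≡ suc (m * suc h)
  x+l = solve-∀

-- The upper bound for even degree.

-- For d = 2 q + 2 the bound on the number of pebbles grows by q + 1 and q alternately.  The
-- rounding slack at odd heights can be spent in either phase, whence two cores: one
-- saves a pebble on the way down, the other on the way up.  At even heights the second
-- core leaves one pebble fewer after the slide.
OddLevel : (d q h w : ℕ) → Set
OddLevel d q h w = Core d h (suc (suc (w + q))) (suc (w + q)) (suc w)
                 × Core d h (suc (w + q)) (suc (suc (w + q))) (suc w)

EvenLevel : (d q h w : ℕ) → Set
EvenLevel d q h w = Core d h p p (suc (suc (w + q))) × Core d h p p (suc (w + q))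
  where p = suc (suc (w + q + q))

module _ {d : ℕ} (q : ℕ) (d≡ : d ≡ suc q + suc q) where

  private
    d≡′ : q + suc (suc q) ≡ d
    d≡′ = trans (+-suc q (suc q)) (sym d≡)

  -- A black child bears its root pebble while being cleared, a white one while being pebbled, so
  -- the pebble saved by `C₁` or `C₂` pays for it. The main child uses `C₁` when the extra sibling
  -- is white and `C₂` when it is black; with fewer white siblings, the latter leaves one pebble
  -- less after the slide.
  odd⇒even : ∀ w → OddLevel d q h w → EvenLevel d q (suc h) w
  odd⇒even w (C₁ , C₂) =
    core-suc q (suc q) (suc (w + q)) (suc (w + q)) d≡′ C₁ C₁ C₂ ≤-refl ≤-refl ≤-refl ≤-refl
      (≤-reflexive (e₁ w q)) (n≤1+n _) (≤-reflexive (e₂ w q))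
      (≤-reflexive (e₃ w q)) (≤-reflexive (e₃ w q)) (≤-reflexive (e₄ w q)) ,
    core-suc (suc q) q (suc (w + q)) (suc (w + q)) (sym d≡) C₂ C₁ C₂ ≤-refl ≤-refl ≤-refl ≤-refl
      (≤-reflexive (e₅ w q)) (≤-reflexive (e₃ w q)) (≤-reflexive (e₆ w q))
      ≤-refl (n≤1+n _) ≤-refl
    where
    e₁ : ∀ w q → q + suc (suc (w + q)) ≡ suc (suc (w + q + q))
    e₁ = solve-∀
    e₂ : ∀ w q → q + (suc w + suc q) ≡ suc (suc (w + q + q))
    e₂ = solve-∀
    e₃ : ∀ w q → suc (w + q) + suc q ≡ suc (suc (w + q + q))
    e₃ = solve-∀
    e₄ : ∀ w q → suc w + suc q ≡ suc (suc (w + q))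
    e₄ = solve-∀
    e₅ : ∀ w q → suc q + suc (w + q) ≡ suc (suc (w + q + q))
    e₅ = solve-∀
    e₆ : ∀ w q → suc q + (suc w + q) ≡ suc (suc (w + q + q))
    e₆ = solve-∀

  -- An extra black sibling charges the way up, an extra white one the way down. In the second core
  -- the count just before the slide is tight, which is where the smaller residue of `C₂` is needed.
  even⇒odd : ∀ w → EvenLevel d q h w → OddLevel d q (suc h) (suc (q + q) + w)
  even⇒odd w (C₁ , C₂) =
    core-suc (suc q) q p p (sym d≡) C₁ C₁ C₁ (n≤1+n p) ≤-refl ≤-refl (n≤1+n p)
      (≤-reflexive (e₁ w q)) (≤-reflexive (e₂ w q)) (≤-reflexive (e₃ w q))
      (≤-reflexive (e₄ w q)) (≤-reflexive (e₄ w q)) (≤-reflexive (e₅ w q)) ,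
    core-suc q (suc q) p p d≡′ C₂ C₂ C₂ (n≤1+n p) ≤-refl ≤-refl (n≤1+n p)
      (≤-reflexive (e₆ w q)) (≤-reflexive (e₄ w q)) (≤-reflexive (e₇ w q))
      (≤-reflexive (e₂ w q)) (≤-reflexive (e₂ w q)) (≤-reflexive (e₈ w q))
    where
    p = suc (suc (w + q + q))
    e₁ : ∀ w q → suc q + suc (suc (w + q + q)) ≡ suc (suc (suc (q + q) + w + q))
    e₁ = solve-∀
    e₂ : ∀ w q → suc (suc (w + q + q)) + suc q ≡ suc (suc (suc (q + q) + w + q))
    e₂ = solve-∀
    e₃ : ∀ w q → suc q + (suc (suc (w + q)) + q) ≡ suc (suc (suc (q + q) + w + q))
    e₃ = solve-∀
    e₄ : ∀ w q → suc (suc (w + q + q)) + q ≡ suc (suc (q + q) + w + q)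
    e₄ = solve-∀
    e₅ : ∀ w q → suc (suc (w + q)) + q ≡ suc (suc (q + q) + w)
    e₅ = solve-∀
    e₆ : ∀ w q → q + suc (suc (w + q + q)) ≡ suc (suc (q + q) + w + q)
    e₆ = solve-∀
    e₇ : ∀ w q → q + (suc (w + q) + suc q) ≡ suc (suc (q + q) + w + q)
    e₇ = solve-∀
    e₈ : ∀ w q → suc (w + q) + suc q ≡ suc (suc (q + q) + w)
    e₈ = solve-∀

  -- A tree with `suc (j * 2)` levels; two levels raise `w` by `suc (q + q)`, which is the degree
  -- minus one.
  odd-level : ∀ j → OddLevel d q (j * 2) (j * suc (q + q))
  odd-level zero    = core-mono z≤n z≤n ≤-refl core-leaf , core-mono z≤n z≤n ≤-refl core-leaf
  odd-level (suc j) = even⇒odd (j * suc (q + q)) (odd⇒even (j * suc (q + q)) (odd-level j))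

-- Evaluation of the bound and conclusion.

halves : ∀ n → ∃[ j ] (n ≡ j * 2 ⊎ n ≡ suc (j * 2))
halves zero = 0 , inj₁ refl
halves (suc n) with halves n
... | j , inj₁ refl = j , inj₂ refl
... | j , inj₂ refl = suc j , inj₁ refl

bound-odd-degree : ∀ m h → bound (m + suc m) h ≡ suc (m * h)
bound-odd-degree m h = trans (cong (λ x → ⌈ x /2⌉ + 1) double)
  (trans (cong (_+ 1) (sym (n≡⌈n+n/2⌉ (m * h)))) (+-comm (m * h) 1))
  where
  double : (m + suc m ∸ 1) * h ≡ m * h + m * h
  double = trans (cong (λ x → (x ∸ 1) * h) (+-suc m m)) (*-distribʳ-+ h m m)

bound-even-degree-odd-height : ∀ q j → bound (suc q + suc q) (suc (j * 2)) ≡ suc (suc (j * suc (q + q) + q))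
bound-even-degree-odd-height q j = trans (cong (λ x → ⌈ x /2⌉ + 1) (double q j))
  (trans (cong (λ x → suc x + 1) (sym (n≡⌊n+n/2⌋ _))) (+-comm _ 1))
  where
  double : ∀ q j → (q + suc q) * suc (j * 2) ≡ suc ((j * suc (q + q) + q) + (j * suc (q + q) + q))
  double = solve-∀

bound-even-degree-even-height : ∀ q j →
  bound (suc q + suc q) (suc (suc (j * 2))) ≡ suc (suc (j * suc (q + q) + q + q))
bound-even-degree-even-height q j = trans (cong (λ x → ⌈ x /2⌉ + 1) (double q j))
  (trans (cong (_+ 1) (sym (n≡⌈n+n/2⌉ (suc (j * suc (q + q) + q + q))))) (+-comm _ 1))
  where
  double : ∀ q j → (q + suc q) * suc (suc (j * 2)) ≡
                   suc (j * suc (q + q) + q + q) + suc (j * suc (q + q) + q + q)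
  double = solve-∀

even-pebbling : ∀ q h → d ≡ suc q + suc q → Pebbling false d (suc h) (bound d (suc h))
even-pebbling q h refl with halves h
... | j , inj₁ refl = subst (Pebbling false _ _) (sym (bound-even-degree-odd-height q j))
  (core-pebbling ≤-refl (n≤1+n _) (s≤s (≤-trans (m≤m+n _ q) (n≤1+n _))) (proj₁ (odd-level q refl j)))
... | j , inj₂ refl = subst (Pebbling false _ _) (sym (bound-even-degree-even-height q j))
  (core-pebbling ≤-refl ≤-refl (s≤s (s≤s (m≤m+n _ q)))
    (proj₁ (odd⇒even q refl (j * suc (q + q)) (odd-level q refl j))))

odd-pebbling : ∀ m h → d ≡ m + suc m → Pebbling false d (suc h) (bound d (suc h))
odd-pebbling m h refl = subst (Pebbling false _ _) (sym (bound-odd-degree m (suc h)))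
  (core-pebbling ≤-refl ≤-refl (s≤s (*-monoʳ-≤ m (n≤1+n h))) (odd-core m h refl))

step-false⇒true : {c c′ : Conf d h} → Step false c c′ → Step true c c′
step-false⇒true (atRoot removeBlack)   = atRoot removeBlack
step-false⇒true (atRoot placeWhite)    = atRoot placeWhite
step-false⇒true (atRoot (slide occ r)) = atRoot (slide occ r)
step-false⇒true (inChild i s)          = inChild i (step-false⇒true s)

pebbling-false⇒true : ∀ {p} → Pebbling false d h p → Pebbling true d h p
pebbling-false⇒true π = record
  { n = len ; seq = seq ; start = start ; finish = finish
  ; steps = λ i → step-false⇒true (steps i) ; rootHit = rootHit ; bounded = bounded }
  where open Pebbling π renaming (n to len)

odd-degree : ∀ d → d % 2 ≡ 1 → d ≡ d / 2 + suc (d / 2)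
odd-degree d odd = trans (m≡m%n+[m/n]*n d 2) (trans (cong (_+ d / 2 * 2) odd) (lemma (d / 2)))
  where
  lemma : ∀ m → 1 + m * 2 ≡ m + suc m
  lemma = solve-∀

even-degree : ∀ d → d % 2 ≡ 0 → 2 ≤ d → ∃[ q ] d ≡ suc q + suc q
even-degree d even 2≤d with d / 2 | trans (m≡m%n+[m/n]*n d 2) (cong (_+ d / 2 * 2) even)
... | zero  | refl = ⊥-elim (1+n≰n (≤-trans 2≤d z≤n))
... | suc q | eq   = q , trans eq (lemma q)
  where
  lemma : ∀ q → suc q * 2 ≡ suc q + suc q
  lemma = solve-∀

odd-lower : ∀ m k → d ≡ m + suc m → ∀ p → Pebbling ws d (suc (suc k)) p → bound d (suc (suc k)) ≤ p
odd-lower m k refl p π = subst (_≤ p) (sym (bound-odd-degree m (suc (suc k))))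
  (peaks⇒lower-bound (odd-peaks m k refl) π)

binary-lower : ∀ k p → Pebbling false 2 (suc (suc k)) p → bound 2 (suc (suc k)) ≤ p
binary-lower k p π = subst (_≤ p) (sym bound≡) (peaks⇒lower-bound (binary-peaks k) π)
  where
  bound≡ : bound 2 (suc (suc k)) ≡ suc (suc ⌈ k /2⌉)
  bound≡ = trans (cong (λ x → suc ⌈ x /2⌉ + 1) (+-identityʳ k)) (+-comm _ 1)

theorem4p2 : ∀ (h : ℕ) → 2 ≤ h →
    (∀ (d : ℕ) → (d ≡ 2 ⊎ (d % 2 ≡ 1 × 3 ≤ d)) → IsBWpebbles false d h (bound d h))
    × (∀ (d : ℕ) → d % 2 ≡ 1 → 3 ≤ d → IsBWpebbles true d h (bound d h))
    × (∀ (d : ℕ) → d % 2 ≡ 0 → 2 ≤ d → Pebbling false d h (bound d h))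
theorem4p2 (suc (suc k)) (s≤s (s≤s _)) = without-white-sliding , with-white-sliding , even
  where
  without-white-sliding : ∀ d → (d ≡ 2 ⊎ (d % 2 ≡ 1 × 3 ≤ d)) →
                          IsBWpebbles false d (suc (suc k)) (bound d (suc (suc k)))
  -- Degree 2 is the even case with `q` equal to 0.
  without-white-sliding .2 (inj₁ refl) = even-pebbling 0 (suc k) refl , binary-lower k
  without-white-sliding d (inj₂ (odd , _)) =
    odd-pebbling (d / 2) (suc k) (odd-degree d odd) , odd-lower (d / 2) k (odd-degree d odd)
  with-white-sliding : ∀ d → d % 2 ≡ 1 → 3 ≤ d → IsBWpebbles true d (suc (suc k)) (bound d (suc (suc k)))
  -- White sliding only adds moves, so the pebbling carries over; the lower bound for odd degree
  -- holds for either value of the flag.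
  with-white-sliding d odd _ =
    pebbling-false⇒true (odd-pebbling (d / 2) (suc k) (odd-degree d odd)) ,
    odd-lower (d / 2) k (odd-degree d odd)
  even : ∀ d → d % 2 ≡ 0 → 2 ≤ d → Pebbling false d (suc (suc k)) (bound d (suc (suc k)))
  even d even 2≤d = let q , d≡ = even-degree d even 2≤d in even-pebbling q (suc k) d≡
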